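{- Let $T$ be a complete first-order theory with $NIP$, $M\models T$, and $M_0^{\Omega}$ a simple randomization of $M$. Then for every $L$-formula $\phi(x;y)$ and all $r<s$ there is a natural number $N$ such that there is no sequence $(\mu_1,\ldots,\mu_N)$ of average measures of elements of $M$ which is shattered by elements in $M_0^\Omega$ for $\phi(x;y)$ and $r<s$.
   Context: For $a_1,\dots,a_k\in M$, the average measure $\mu={\rm Ave}(a_1,\dots,a_k)$ is the Keisler measure in $x$ with $\mu(\phi(x;b))=\frac1k|\{j\le k: M\models\phi(a_j;b)\}|$ for $b\in M$. For a model $M$ of $T$ and an atomless finitely additive probability space $(\Omega_0,\mathcal B_0,\mu_0)$, the simple randomization $M_0^\Omega$ is the set of functions $f:\Omega_0\to M$ with finite image and $f^{ -1}(\{m\})\in\mathcal B_0$ for all $m$. A sequence $(\mu_i:i<N)$ of average measures is shattered by elements in $M_0^\Omega$ (equivalently, by averages of elements of $M$) for $\phi(x;y)$ and $r<s$ if for every $I\subseteq\{i:i<N\}$ there are $t\in\mathbb N$ and $b_1^I,\dots,b_t^I\in M$ with $\frac1t\sum_{j=1}^t\mu_i(\phi(x;b^I_j))\le r$ for $i\in I$ and $\frac1t\sum_{j=1}^t\mu_i(\phi(x;b^I_j))\ge s$ for $i\notin I$. -}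

module Defs where

open import Level using (Level; suc; zero) renaming (_⊔_ to _⊔ˡ_)
open import Data.Nat using (ℕ) renaming (suc to sucℕ; zero to zeroℕ; _+_ to _+ℕ_)
open import Data.Fin using (Fin) renaming (zero to fzero; suc to fsuc)
open import Data.Bool using (Bool; true; false)
open import Data.Integer using (+_)
open import Data.Rational using (ℚ; 0ℚ; _≤_; _<_) renaming (_+_ to _+ℚ_; _*_ to _*ℚ_; _/_ to _/ℚ_)
open import Data.Vec.Functional using (Vector; _++_; _∷_)
open import Data.Product using (Σ; _×_; ∃; _,_)
open import Data.Sum using (_⊎_)
open import Data.Empty using (⊥)
open import Data.Unit using (⊤)
open import Relation.Nullary using (¬_)
open import Relation.Binary.PropositionalEquality using (_≡_)
open import Function.Bundles using (_⇔_)

record Signature : Set₁ where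
  field
    FunSym   : Set
    funArity : FunSym → ℕ
    RelSym   : Set
    relArity : RelSym → ℕ
open Signature public

module _ (L : Signature) where

  data Term (n : ℕ) : Set where
    var : Fin n → Term n
    app : (f : FunSym L) → (Fin (funArity L f) → Term n) → Term n

  -- formulas with free variables among Fin n; quantifiers bind variable 0
  data Formula : ℕ → Set where
    ⊥'  : ∀ {n} → Formula n
    ⊤'  : ∀ {n} → Formula n
    rel : ∀ {n} (R : RelSym L) → (Fin (relArity L R) → Term n) → Formula n
    _≐_ : ∀ {n} → Term n → Term n → Formula n
    ¬'_ : ∀ {n} → Formula n → Formula n
    _∧'_ : ∀ {n} → Formula n → Formula n → Formula n
    _∨'_ : ∀ {n} → Formula n → Formula n → Formula n
    _⇒'_ : ∀ {n} → Formula n → Formula n → Formula n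
    ∀'  : ∀ {n} → Formula (sucℕ n) → Formula n
    ∃'  : ∀ {n} → Formula (sucℕ n) → Formula n

  Sentence : Set
  Sentence = Formula 0

  record Structure : Set₁ where
    field
      Carrier : Set
      funI    : (f : FunSym L) → (Fin (funArity L f) → Carrier) → Carrier
      relI    : (R : RelSym L) → (Fin (relArity L R) → Carrier) → Set
  open Structure public

  module _ (M : Structure) where
    eval : ∀ {n} → (Fin n → Carrier M) → Term n → Carrier M
    eval ρ (var i)    = ρ i
    eval ρ (app f ts) = funI M f (λ i → eval ρ (ts i))

    Sat : ∀ {n} → Formula n → (Fin n → Carrier M) → Set
    Sat ⊥'        ρ = ⊥
    Sat ⊤'        ρ = ⊤
    Sat (rel R ts) ρ = relI M R (λ i → eval ρ (ts i))
    Sat (t ≐ u)   ρ = eval ρ t ≡ eval ρ u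
    Sat (¬' φ)    ρ = ¬ Sat φ ρ
    Sat (φ ∧' ψ)  ρ = Sat φ ρ × Sat ψ ρ
    Sat (φ ∨' ψ)  ρ = Sat φ ρ ⊎ Sat ψ ρ
    Sat (φ ⇒' ψ)  ρ = Sat φ ρ → Sat ψ ρ
    Sat (∀' φ)    ρ = (a : Carrier M) → Sat φ (a ∷ ρ)
    Sat (∃' φ)    ρ = Σ (Carrier M) λ a → Sat φ (a ∷ ρ)

    SatP : ∀ {nx ny} → Formula (nx +ℕ ny) → (Fin nx → Carrier M) → (Fin ny → Carrier M) → Set
    SatP φ a b = Sat φ (a ++ b)

  SatS : Structure → Sentence → Set
  SatS M σ = Sat M σ (λ ())

  Theory : Set₁
  Theory = Sentence → Set

  IsModel : Theory → Structure → Set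
  IsModel T M = ∀ σ → T σ → SatS M σ

  Complete : Theory → Set₁
  Complete T = (Σ Structure (IsModel T))
             × (∀ σ → (∀ M → IsModel T M → SatS M σ) ⊎ (∀ M → IsModel T M → SatS M (¬' σ)))

  ShattersIn : ∀ nx ny → Formula (nx +ℕ ny) → ℕ → Structure → Set
  ShattersIn nx ny φ n N =
    Σ (Fin n → Fin nx → Carrier N) λ a →
    Σ ((Fin n → Bool) → Fin ny → Carrier N) λ b →
    ∀ (I : Fin n → Bool) (i : Fin n) → (I i ≡ true) ⇔ SatP N φ (a i) (b I)

  NIPFormula : Theory → ∀ nx ny → Formula (nx +ℕ ny) → Set₁
  NIPFormula T nx ny φ = Σ ℕ λ n → ∀ N → IsModel T N → ¬ ShattersIn nx ny φ n N

  NIP : Theory → Set₁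
  NIP T = ∀ nx ny (φ : Formula (nx +ℕ ny)) → NIPFormula T nx ny φ

countTrue : ∀ {n} → (Fin n → Bool) → ℕ
countTrue {zeroℕ}  v = 0
countTrue {sucℕ n} v with v fzero
... | true  = sucℕ (countTrue (λ i → v (fsuc i)))
... | false = countTrue (λ i → v (fsuc i))

sumℚ : ∀ {n} → (Fin n → ℚ) → ℚ
sumℚ {zeroℕ}  f = 0ℚ
sumℚ {sucℕ n} f = f fzero +ℚ sumℚ (λ i → f (fsuc i))

-- Average measures Ave(a_1,…,a_k), k ≥ 1 (k = suc k′)

module _ {L : Signature} (M : Structure L) where

  record AveMeasure (nx : ℕ) : Set where
    constructor ave
    field
      k′  : ℕ
      pts : Fin (sucℕ k′) → Fin nx → Carrier M
  open AveMeasure public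

  MeasureIs : ∀ {nx ny} → AveMeasure nx → Formula L (nx +ℕ ny) → (Fin ny → Carrier M) → ℚ → Set
  MeasureIs μ φ b q =
    Σ (Fin (sucℕ (k′ μ)) → Bool) λ v →
      (∀ j → (v j ≡ true) ⇔ SatP L M φ (pts μ j) b)
      × (q ≡ (+ countTrue v) /ℚ sucℕ (k′ μ))

  -- the sequence (μ_i : i < N) is shattered by averages of elements of M
  -- (equivalently by elements of M_0^Ω) for φ(x;y) and r < s
  ShatteredByAverages : ∀ {nx ny} (N : ℕ) → (Fin N → AveMeasure nx) → Formula L (nx +ℕ ny) → ℚ → ℚ → Set
  ShatteredByAverages {nx} {ny} N μ φ r s =
    ∀ (I : Fin N → Bool) →
      Σ ℕ λ t′ →
      Σ (Fin (sucℕ t′) → Fin ny → Carrier M) λ b →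
      Σ (Fin N → Fin (sucℕ t′) → ℚ) λ q →
        (∀ i j → MeasureIs (μ i) φ (b j) (q i j))
        × (∀ i → (I i ≡ true  → ((+ 1) /ℚ sucℕ t′) *ℚ sumℚ (q i) ≤ r)
               × (I i ≡ false → s ≤ ((+ 1) /ℚ sucℕ t′) *ℚ sumℚ (q i)))

{-# OPTIONS --safe #-}

-- Let (μ_i) be shattered by the averages ν_I, and put sgn = +1 for i ∉ I and -1 for i ∈ I. Averaged
-- over all I, the number Σ_i sgn · (μ_i ⊗ ν_I)(φ) is at least N (s - r) / 2. Choosing a best point a_i
-- of each μ_i, and then a best point b_I of each ν_I, gives traces c_I = (φ(a_i; b_I))_i for which
-- Σ_i sgn · c_I(i) still has mean at least N (s - r) / 2. For a single trace this sum exceeds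
-- N (s - r) / 4 only for an exponentially small proportion of the sets I (exponential moments),
-- whereas by NIP and the Sauer–Shelah lemma there are only subexponentially many traces.
-- Hence N is bounded.

module Submission where

open import Defs
open import Data.Nat as ℕ using (ℕ; zero; suc; NonZero) renaming (_+_ to _+ℕ_)
import Data.Nat.Properties as ℕ
open import Data.Bool using (Bool; true; false; _∧_; _∨_; not)
open import Data.Bool.Properties using () renaming (_≟_ to _≟ᵇ_)
open import Data.Empty using (⊥-elim)
open import Data.Fin using (Fin) renaming (zero to fzero; suc to fsuc)
open import Data.Fin.Subset.Properties using (anySubset?)
open import Data.Integer as ℤ using () renaming (+_ to pos)
import Data.Integer.Properties as ℤ
open import Data.Product using (Σ; _,_; _×_; ∃; proj₁; proj₂)
open import Data.Sum using (inj₁; inj₂)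
open import Data.Vec using (Vec; []; _∷_; lookup; map; tabulate)
open import Data.Vec.Properties using (lookup∘tabulate; ≡-dec)
open import Function using (_∘_)
open import Function.Bundles using (_⇔_)
open import Relation.Nullary using (¬_; Dec; yes; no; does)
open import Relation.Nullary.Decidable using (dec-true)
open import Relation.Binary.PropositionalEquality

module TraceCounting where

  open import Data.Nat using (_+_; _*_; _^_; _∸_; _≤_; _<_; _≤?_; z≤n; s≤s)
  open import Data.Nat.Properties
  open import Data.Nat.Tactic.RingSolver using (solve-∀)

  -- Power inequalities over the natural numbers.

  ^-distribʳ-* : ∀ m n k → (m * n) ^ k ≡ m ^ k * n ^ k
  ^-distribʳ-* m n zero = refl
  ^-distribʳ-* m n (suc k) rewrite ^-distribʳ-* m n k = lemma m n (m ^ k) (n ^ k)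
    where
    lemma : ∀ m n p q → m * n * (p * q) ≡ m * p * (n * q)
    lemma = solve-∀

  [m*n^o]^p≡m^p*n^[o*p] : ∀ m n o p → (m * n ^ o) ^ p ≡ m ^ p * n ^ (o * p)
  [m*n^o]^p≡m^p*n^[o*p] m n o p = trans (^-distribʳ-* m (n ^ o) p) (cong (m ^ p *_) (^-*-assoc n o p))

  -- (1 - 1/(g+1))^E ≥ 1 - E/(g+1), with denominators cleared.
  bernoulli-∸ : ∀ g E → suc g ^ suc E ≤ g ^ E * suc g + E * suc g ^ E
  bernoulli-∸ g zero = ≤-reflexive (lemma g)
    where
    lemma : ∀ g → suc g * 1 ≡ 1 * suc g + 0
    lemma = solve-∀
  bernoulli-∸ g (suc E) = begin
    suc g * (suc g * X)                            ≡⟨⟩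
    suc g * X + g * (suc g * X)                    ≤⟨ +-monoʳ-≤ (suc g * X) (*-monoʳ-≤ g (bernoulli-∸ g E)) ⟩
    suc g * X + g * (Y * suc g + E * X)            ≤⟨ m≤m+n _ (E * X) ⟩
    suc g * X + g * (Y * suc g + E * X) + E * X    ≡⟨ collect g E X Y ⟩
    g * Y * suc g + suc E * (suc g * X)            ∎
    where
    open ≤-Reasoning
    X = suc g ^ E
    Y = g ^ E
    collect : ∀ g E X Y →
      suc g * X + g * (Y * suc g + E * X) + E * X ≡ g * Y * suc g + suc E * (suc g * X)
    collect = solve-∀

  -- (1 + 1/b)^d ≥ 1 + d/b, with denominators cleared.
  bernoulli-+ : ∀ b d → b ^ d * (b + d) ≤ suc b ^ d * b
  bernoulli-+ b zero = ≤-reflexive (cong (1 *_) (+-identityʳ b))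
  bernoulli-+ b (suc d) = begin
    b * X * (b + suc d)            ≤⟨ m≤m+n _ (X * d) ⟩
    b * X * (b + suc d) + X * d    ≡⟨ collect b d X ⟩
    suc b * (X * (b + d))          ≤⟨ *-monoʳ-≤ (suc b) (bernoulli-+ b d) ⟩
    suc b * (suc b ^ d * b)        ≡⟨ *-assoc (suc b) (suc b ^ d) b ⟨
    suc b * suc b ^ d * b          ∎
    where
    open ≤-Reasoning
    X = b ^ d
    collect : ∀ b d X → b * X * (b + suc d) + X * d ≡ suc b * (X * (b + d))
    collect = solve-∀

  -- Divided by `x * suc h`, the hypothesis reads y/x < 1 - E/(h+1), and by `bernoulli-∸` the
  -- right-hand side is at most (h/(h+1))^E.
  power-ratio-gap : ∀ x y h E → y * suc h + x * E < x * suc h → y * suc h ^ E < x * h ^ E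
  power-ratio-gap x y h E gap =
    *-cancelʳ-< (suc h) (y * H) (x * h ^ E) (+-cancelʳ-< (x * E * H) _ _ (begin-strict
    y * H * suc h + x * E * H                ≡⟨ collect x y (suc h) E H ⟩
    (y * suc h + x * E) * H                  <⟨ *-monoˡ-< H {{m^n≢0 (suc h) E}} gap ⟩
    x * suc h * H                            ≡⟨ *-assoc x (suc h) H ⟩
    x * (suc h * H)                          ≤⟨ *-monoʳ-≤ x (bernoulli-∸ h E) ⟩
    x * (h ^ E * suc h + E * H)              ≡⟨ expand x (suc h) E H (h ^ E) ⟩
    x * h ^ E * suc h + x * E * H            ∎))
    where
    open ≤-Reasoning
    H = suc h ^ E
    collect : ∀ x y k E H → y * H * k + x * E * H ≡ (y * k + x * E) * H
    collect = solve-∀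
    expand : ∀ x k E H X → x * (X * k + E * H) ≡ x * X * k + x * E * H
    expand = solve-∀

  -- By `bernoulli-+`, ((b+1)/b)^d is at least (b+d)/b, and the exponent d = c b + 1 makes this
  -- larger than c.
  power-dominates : ∀ b c .{{_ : NonZero b}} → c * b ^ suc (c * b) < suc b ^ suc (c * b)
  power-dominates b c = *-cancelʳ-< b (c * X) (suc b ^ d) (begin-strict
    c * X * b            ≡⟨ swap c X b ⟩
    X * (c * b)          <⟨ *-monoʳ-< X {{m^n≢0 b d}} (<-≤-trans (n<1+n (c * b)) (m≤n+m d b)) ⟩
    X * (b + d)          ≤⟨ bernoulli-+ b d ⟩
    suc b ^ d * b        ∎)
    where
    open ≤-Reasoning
    d = suc (c * b)
    X = b ^ d
    swap : ∀ c X b → c * X * b ≡ X * (c * b)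
    swap = solve-∀

  -- Sums over the Boolean cube.

  cubeSum : {A : Set} → (A → A → A) → ∀ {N} → (Vec Bool N → A) → A
  cubeSum _⊕_ {zero}  f = f []
  cubeSum _⊕_ {suc N} f = cubeSum _⊕_ (f ∘ (true ∷_)) ⊕ cubeSum _⊕_ (f ∘ (false ∷_))

  cubeSum-homo : {A B : Set} (_⊕_ : A → A → A) (_⊗_ : B → B → B) (h : A → B) →
    (∀ x y → h (x ⊕ y) ≡ h x ⊗ h y) →
    ∀ {N} (f : Vec Bool N → A) → h (cubeSum _⊕_ f) ≡ cubeSum _⊗_ (h ∘ f)
  cubeSum-homo _⊕_ _⊗_ h h-⊕ {zero}  f = refl
  cubeSum-homo _⊕_ _⊗_ h h-⊕ {suc N} f = trans (h-⊕ _ _)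
    (cong₂ _⊗_ (cubeSum-homo _⊕_ _⊗_ h h-⊕ (f ∘ (true ∷_))) (cubeSum-homo _⊕_ _⊗_ h h-⊕ (f ∘ (false ∷_))))

  -- Taking `≼` to be equality or `≤` yields both congruence and monotonicity, for the sums in ℕ and
  -- for those in ℚ.
  cubeSum-preserves : {A : Set} (_⊕_ : A → A → A) (_≼_ : A → A → Set) →
    (∀ {w x y z} → w ≼ x → y ≼ z → (w ⊕ y) ≼ (x ⊕ z)) →
    ∀ {N} {f g : Vec Bool N → A} → (∀ v → f v ≼ g v) → cubeSum _⊕_ f ≼ cubeSum _⊕_ g
  cubeSum-preserves _⊕_ _≼_ mono {zero}  f≼g = f≼g []
  cubeSum-preserves _⊕_ _≼_ mono {suc N} f≼g = mono
    (cubeSum-preserves _⊕_ _≼_ mono (f≼g ∘ (true ∷_))) (cubeSum-preserves _⊕_ _≼_ mono (f≼g ∘ (false ∷_)))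

  cubeSum-distrib : {A : Set} (_⊕_ : A → A → A) →
    (∀ w x y z → (w ⊕ x) ⊕ (y ⊕ z) ≡ (w ⊕ y) ⊕ (x ⊕ z)) →
    ∀ {N} (f g : Vec Bool N → A) → cubeSum _⊕_ (λ v → f v ⊕ g v) ≡ cubeSum _⊕_ f ⊕ cubeSum _⊕_ g
  cubeSum-distrib _⊕_ interchange {zero}  f g = refl
  cubeSum-distrib _⊕_ interchange {suc N} f g = trans
    (cong₂ _⊕_ (cubeSum-distrib _⊕_ interchange (f ∘ (true ∷_)) (g ∘ (true ∷_)))
               (cubeSum-distrib _⊕_ interchange (f ∘ (false ∷_)) (g ∘ (false ∷_))))
    (interchange _ _ _ _)

  +-interchange : ∀ w x y z → (w + x) + (y + z) ≡ (w + y) + (x + z)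
  +-interchange = solve-∀

  ∑ : ∀ {N} → (Vec Bool N → ℕ) → ℕ
  ∑ = cubeSum _+_

  ∑-cong : ∀ {N} {f g : Vec Bool N → ℕ} → (∀ v → f v ≡ g v) → ∑ f ≡ ∑ g
  ∑-cong = cubeSum-preserves _+_ _≡_ (cong₂ _+_)

  ∑-mono-≤ : ∀ {N} {f g : Vec Bool N → ℕ} → (∀ v → f v ≤ g v) → ∑ f ≤ ∑ g
  ∑-mono-≤ = cubeSum-preserves _+_ _≤_ +-mono-≤

  ∑-distrib-+ : ∀ {N} (f g : Vec Bool N → ℕ) → ∑ (λ v → f v + g v) ≡ ∑ f + ∑ g
  ∑-distrib-+ = cubeSum-distrib _+_ +-interchange

  *-distribˡ-∑ : ∀ {N} c (f : Vec Bool N → ℕ) → c * ∑ f ≡ ∑ (λ v → c * f v)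
  *-distribˡ-∑ c = cubeSum-homo _+_ _+_ (c *_) (*-distribˡ-+ c)

  *-distribʳ-∑ : ∀ {N} c (f : Vec Bool N → ℕ) → ∑ f * c ≡ ∑ (λ v → f v * c)
  *-distribʳ-∑ c = cubeSum-homo _+_ _+_ (_* c) (*-distribʳ-+ c)

  ∑-comm : ∀ {M N} (f : Vec Bool M → Vec Bool N → ℕ) → ∑ (λ u → ∑ (f u)) ≡ ∑ (λ v → ∑ (λ u → f u v))
  ∑-comm {zero}  f = refl
  ∑-comm {suc M} f = trans (cong₂ _+_ (∑-comm (f ∘ (true ∷_))) (∑-comm (f ∘ (false ∷_))))
    (sym (∑-distrib-+ (λ v → ∑ (λ u → f (true ∷ u) v)) (λ v → ∑ (λ u → f (false ∷ u) v))))

  ∑-const : ∀ N c → ∑ {N} (λ _ → c) ≡ 2 ^ N * c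
  ∑-const zero    c = sym (+-identityʳ c)
  ∑-const (suc N) c rewrite ∑-const N c = lemma (2 ^ N) c
    where
    lemma : ∀ p c → p * c + p * c ≡ 2 * p * c
    lemma = solve-∀

  term≤∑ : ∀ {N} (f : Vec Bool N → ℕ) v → f v ≤ ∑ f
  term≤∑ f []          = ≤-refl
  term≤∑ f (true  ∷ v) = ≤-trans (term≤∑ (f ∘ (true ∷_)) v) (m≤m+n _ _)
  term≤∑ f (false ∷ v) = ≤-trans (term≤∑ (f ∘ (false ∷_)) v) (m≤n+m _ _)

  -- Set families and the Sauer-Shelah bound.

  indicator : Bool → ℕ
  indicator true  = 1
  indicator false = 0

  card : ∀ {N} → (Vec Bool N → Bool) → ℕ
  card C = ∑ (indicator ∘ C)

  -- The family is Boolean-valued so that its members can be counted. Realising every `J` forces `f`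
  -- to be injective.
  Shatters : ∀ {N} → (Vec Bool N → Bool) → ℕ → Set
  Shatters {N} C n = Σ (Fin n → Fin N) λ f →
    ∀ (J : Fin n → Bool) → ∃ λ c → C c ≡ true × (∀ l → lookup c (f l) ≡ J l)

  module _ {N} (C : Vec Bool (suc N) → Bool) where

    projection link : Vec Bool N → Bool
    projection v = C (true ∷ v) ∨ C (false ∷ v)
    link       v = C (true ∷ v) ∧ C (false ∷ v)

    -- A vector with both extensions in `C` is counted once in the projection and once more in the
    -- link; one with a single extension in `C` is counted in the projection alone.
    card-projection-link : card C ≡ card projection + card link
    card-projection-link = begin
      card C                                              ≡⟨ ∑-distrib-+ (indicator ∘ C ∘ (true ∷_)) (indicator ∘ C ∘ (false ∷_)) ⟨
      ∑ (λ v → indicator (C (true ∷ v)) + indicator (C (false ∷ v)))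
        ≡⟨ ∑-cong (λ v → inclusion-exclusion (C (true ∷ v)) (C (false ∷ v))) ⟩
      ∑ (λ v → indicator (projection v) + indicator (link v)) ≡⟨ ∑-distrib-+ (indicator ∘ projection) (indicator ∘ link) ⟩
      card projection + card link                         ∎
      where
      open ≡-Reasoning
      inclusion-exclusion : ∀ a b → indicator a + indicator b ≡ indicator (a ∨ b) + indicator (a ∧ b)
      inclusion-exclusion true  true  = refl
      inclusion-exclusion true  false = refl
      inclusion-exclusion false true  = refl
      inclusion-exclusion false false = refl

    projection-Shatters : ∀ {n} → Shatters projection n → Shatters C n
    projection-Shatters (f , sh) = fsuc ∘ f , extend
      where
      extend : ∀ J → ∃ λ c → C c ≡ true × (∀ l → lookup c (fsuc (f l)) ≡ J l)
      extend J with sh J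
      ... | c , c∈ , eq with C (true ∷ c) in t
      ...   | true  = true ∷ c , t , eq
      ...   | false = false ∷ c , c∈ , eq

    -- A member of the link extends by either bit, so coordinate zero joins the shattered
    -- coordinates. This is why the bound on the dimension drops by one for the link in the
    -- Sauer-Shelah recursion.
    link-Shatters : ∀ {n} → Shatters link n → Shatters C (suc n)
    link-Shatters {n} (f , sh) = f⁺ , extend
      where
      f⁺ : Fin (suc n) → Fin (suc N)
      f⁺ fzero    = fzero
      f⁺ (fsuc l) = fsuc (f l)
      both : ∀ b c → link c ≡ true → C (b ∷ c) ≡ true
      both b c c∈ with C (true ∷ c) in t | C (false ∷ c) in f
      both true  c c∈ | true | true = t
      both false c c∈ | true | true = f
      extend : ∀ J → ∃ λ c → C c ≡ true × (∀ l → lookup c (f⁺ l) ≡ J l)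
      extend J with sh (J ∘ fsuc)
      ... | c , c∈ , eq = J fzero ∷ c , both (J fzero) c c∈ , λ { fzero → refl ; (fsuc l) → eq l }

  -- The weight g turns the Sauer–Shelah recursion into (g+1)^(N+1) = g (g+1)^N + (g+1)^N.
  sauer-shelah : ∀ g .{{_ : NonZero g}} N n (C : Vec Bool N → Bool) → ¬ Shatters C n →
    card C * g ^ N ≤ g ^ n * suc g ^ N
  sauer-shelah g N zero C ¬sh = ≤-trans (≤-reflexive (cong (_* g ^ N) empty)) z≤n
    where
    notIn : ∀ v → indicator (C v) ≡ 0
    notIn v with C v in eq
    -- For n = 0, a single member of `C` already shatters the empty set of coordinates.
    ... | true  = ⊥-elim (¬sh ((λ ()) , λ J → v , eq , λ ()))
    ... | false = refl
    empty : card C ≡ 0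
    empty = trans (∑-cong notIn) (trans (∑-const N 0) (*-zeroʳ (2 ^ N)))
  sauer-shelah g zero (suc n) C ¬sh = begin
    indicator (C []) * 1   ≤⟨ *-monoˡ-≤ 1 (indicator≤1 (C [])) ⟩
    1                      ≤⟨ m^n>0 g (suc n) ⟩
    g ^ suc n              ≡⟨ *-identityʳ _ ⟨
    g ^ suc n * 1          ∎
    where
    open ≤-Reasoning
    indicator≤1 : ∀ b → indicator b ≤ 1
    indicator≤1 true  = ≤-refl
    indicator≤1 false = z≤n
  sauer-shelah g (suc N) (suc n) C ¬sh = begin
    card C * (g * g ^ N)                             ≡⟨ cong (_* (g * g ^ N)) (card-projection-link C) ⟩
    (p + q) * (g * g ^ N)                            ≡⟨ expand g p q (g ^ N) ⟩
    g * (p * g ^ N) + g * (q * g ^ N)                ≤⟨ +-mono-≤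
        (*-monoʳ-≤ g (sauer-shelah g N (suc n) (projection C) (¬sh ∘ projection-Shatters C)))
        (*-monoʳ-≤ g (sauer-shelah g N n (link C) (¬sh ∘ link-Shatters C))) ⟩
    g * (g * g ^ n * suc g ^ N) + g * (g ^ n * suc g ^ N) ≡⟨ collect g (g ^ n) (suc g ^ N) ⟩
    g * g ^ n * (suc g * suc g ^ N)                  ∎
    where
    open ≤-Reasoning
    p = card (projection C)
    q = card (link C)
    expand : ∀ g p q X → (p + q) * (g * X) ≡ g * (p * X) + g * (q * X)
    expand = solve-∀
    collect : ∀ g X Y → g * (g * X * Y) + g * (X * Y) ≡ g * X * (suc g * Y)
    collect = solve-∀

  -- Scores of traces and their exponential moments.

  -- gain σ c is 1 + sgn σ · c, where sgn true = -1 since I i = true asks for a small average.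
  gain : Bool → Bool → ℕ
  gain true  true  = 0
  gain false true  = 2
  gain _     false = 1

  -- This is N + Σ_i sgn · c_i; the shift by N keeps the signed sum a natural number.
  score : ∀ {N} → Vec Bool N → Vec Bool N → ℕ
  score []      []      = 0
  score (b ∷ I) (x ∷ c) = gain b x + score I c

  -- On each coordinate the two gains are 1 + z and 1 - z. The score against the complement is
  -- therefore N minus the signed sum, available as an exponent without subtraction.
  score-not : ∀ {N} (I c : Vec Bool N) → score I c + score (map not I) c ≡ N + N
  score-not []      []      = refl
  score-not {suc N} (b ∷ I) (x ∷ c) = begin
    (gain b x + P) + (gain (not b) x + Q)   ≡⟨ +-interchange (gain b x) P (gain (not b) x) Q ⟩
    (gain b x + gain (not b) x) + (P + Q)   ≡⟨ cong₂ _+_ (gain-not b x) (score-not I c) ⟩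
    2 + (N + N)                             ≡⟨ cong suc (+-suc N N) ⟨
    suc N + suc N                           ∎
    where
    open ≡-Reasoning
    P = score I c
    Q = score (map not I) c
    gain-not : ∀ b x → gain b x + gain (not b) x ≡ 2
    gain-not true  true  = refl
    gain-not false true  = refl
    gain-not true  false = refl
    gain-not false false = refl

  score≤N+N : ∀ {N} (I c : Vec Bool N) → score I c ≤ N + N
  score≤N+N I c = ≤-trans (m≤m+n _ _) (≤-reflexive (score-not I c))

  module _ (y : ℕ) where

    -- Up to the factor ((y + 1) y)^N, this is the exponential moment ((y + 1) / y)^(Σ_i sgn · c_i).
    weight : ∀ {N} → Vec Bool N → Vec Bool N → ℕ
    weight I c = suc y ^ score I c * y ^ score (map not I) c

    weight-∷ : ∀ {N} b x (I c : Vec Bool N) →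
      weight (b ∷ I) (x ∷ c) ≡ suc y ^ gain b x * y ^ gain (not b) x * weight I c
    weight-∷ b x I c = trans
      (cong₂ _*_ (^-distribˡ-+-* (suc y) (gain b x) _) (^-distribˡ-+-* y (gain (not b) x) _))
      (interchange (suc y ^ gain b x) _ (y ^ gain (not b) x) _)
      where
      interchange : ∀ p q r s → p * q * (r * s) ≡ p * r * (q * s)
      interchange = solve-∀

    -- The sum over I factorises over the coordinates. A coordinate with c_i = 1 contributes (y+1)^2
    -- + y^2 = 2 (y+1) y + 1, one with c_i = 0 contributes 2 (y+1) y; the larger value bounds both.
    ∑-weight : ∀ {N} (c : Vec Bool N) → ∑ (λ I → weight I c) ≤ suc (2 * (suc y * y)) ^ N
    ∑-weight []      = ≤-refl
    ∑-weight {suc N} (x ∷ c) = begin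
      ∑ (λ I → weight (true ∷ I) (x ∷ c)) + ∑ (λ I → weight (false ∷ I) (x ∷ c))
        ≡⟨ cong₂ _+_ (factor true) (factor false) ⟩
      coeff true * S + coeff false * S  ≡⟨ *-distribʳ-+ S (coeff true) (coeff false) ⟨
      (coeff true + coeff false) * S    ≤⟨ *-mono-≤ (coeff-sum x) (∑-weight c) ⟩
      h * h ^ N                         ∎
      where
      open ≤-Reasoning
      h = suc (2 * (suc y * y))
      S = ∑ (λ I → weight I c)
      coeff : Bool → ℕ
      coeff b = suc y ^ gain b x * y ^ gain (not b) x
      factor : ∀ b → ∑ (λ I → weight (b ∷ I) (x ∷ c)) ≡ coeff b * S
      factor b = trans (∑-cong (λ I → weight-∷ b x I c)) (sym (*-distribˡ-∑ (coeff b) (λ I → weight I c)))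
      coeff-sum : ∀ x → suc y ^ gain true x * y ^ gain false x + suc y ^ gain false x * y ^ gain true x ≤ h
      coeff-sum true = ≤-reflexive (lemma y)
        where
        lemma : ∀ y → 1 * (y * (y * 1)) + suc y * (suc y * 1) * 1 ≡ suc (2 * (suc y * y))
        lemma = solve-∀
      coeff-sum false = ≤-trans (≤-reflexive (lemma y)) (n≤1+n _)
        where
        lemma : ∀ y → suc y * 1 * (y * 1) + suc y * 1 * (y * 1) ≡ 2 * (suc y * y)
        lemma = solve-∀

    -- Writing the score as N + d + δ, the complementary score is N - d - δ. So the weight is ((y+1)
    -- y)^N times ((y+1)/y)^(d+δ), and the surplus δ can only increase it.
    high-score-weight : ∀ {N} d (I c : Vec Bool N) → N + d ≤ score I c →
      suc y ^ d * (suc y * y) ^ N ≤ weight I c * y ^ d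
    high-score-weight {N} d I c high = begin
      x ^ d * (x * y) ^ N                    ≡⟨ cong (x ^ d *_) (^-distribʳ-* x y N) ⟩
      x ^ d * (x ^ N * y ^ N)                ≡⟨ cong (λ n → x ^ d * (x ^ N * y ^ n)) N≡ ⟨
      x ^ d * (x ^ N * y ^ (Q + d + δ))      ≡⟨ cong (λ z → x ^ d * (x ^ N * z)) (split-^ y Q d δ) ⟩
      x ^ d * (x ^ N * (y ^ Q * y ^ d * y ^ δ)) ≤⟨ *-monoʳ-≤ (x ^ d) (*-monoʳ-≤ (x ^ N)
                                                  (*-monoʳ-≤ (y ^ Q * y ^ d) (^-monoˡ-≤ δ (n≤1+n y)))) ⟩
      x ^ d * (x ^ N * (y ^ Q * y ^ d * x ^ δ)) ≡⟨ rearrange (x ^ d) (x ^ N) (y ^ Q) (y ^ d) (x ^ δ) ⟩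
      x ^ N * x ^ d * x ^ δ * y ^ Q * y ^ d  ≡⟨ cong (λ z → z * y ^ Q * y ^ d) (split-^ x N d δ) ⟨
      x ^ (N + d + δ) * y ^ Q * y ^ d        ≡⟨ cong (λ n → x ^ n * y ^ Q * y ^ d) (m+[n∸m]≡n high) ⟩
      x ^ P * y ^ Q * y ^ d                  ∎
      where
      open ≤-Reasoning
      x = suc y
      P = score I c
      Q = score (map not I) c
      δ = P ∸ (N + d)
      split-^ : ∀ m a b c → m ^ (a + b + c) ≡ m ^ a * m ^ b * m ^ c
      split-^ m a b c = trans (^-distribˡ-+-* m (a + b) c) (cong (_* m ^ c) (^-distribˡ-+-* m a b))
      rearrange : ∀ p q r s t → p * (q * (r * s * t)) ≡ q * p * t * r * s
      rearrange = solve-∀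
      N≡ : Q + d + δ ≡ N
      N≡ = +-cancelˡ-≡ N _ _ (trans (move N Q d δ) (trans (cong (_+ Q) (m+[n∸m]≡n high)) (score-not I c)))
        where
        move : ∀ N Q d δ → N + (Q + d + δ) ≡ N + d + δ + Q
        move = solve-∀

    -- A pointwise form of Markov's inequality: scores below N + d are covered by the first term,
    -- and a higher score, being at most 2N, exceeds it by at most N, which the large weight pays
    -- for.
    score-weight : ∀ {N} d (I c : Vec Bool N) → let τ = suc y ^ d * (suc y * y) ^ N in
      score I c * τ ≤ (N + d) * τ + N * y ^ d * weight I c
    score-weight {N} d I c with N + d ≤? score I c
    ... | no low = ≤-trans (*-monoˡ-≤ τ (<⇒≤ (≰⇒> low))) (m≤m+n _ _)
      where
      τ = suc y ^ d * (suc y * y) ^ N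
    ... | yes high = begin
      score I c * τ                        ≤⟨ *-monoˡ-≤ τ (score≤N+N I c) ⟩
      (N + N) * τ                          ≡⟨ *-distribʳ-+ τ N N ⟩
      N * τ + N * τ                        ≤⟨ +-mono-≤ (*-monoˡ-≤ τ (m≤m+n N d)) (*-monoʳ-≤ N (high-score-weight d I c high)) ⟩
      (N + d) * τ + N * (w * y ^ d)        ≡⟨ cong ((N + d) * τ +_) (move N w (y ^ d)) ⟩
      (N + d) * τ + N * y ^ d * w          ∎
      where
      open ≤-Reasoning
      τ = suc y ^ d * (suc y * y) ^ N
      w = weight I c
      move : ∀ N w z → N * (w * z) ≡ N * z * w
      move = solve-∀

    -- A union bound: since the trace varies with I, its weight is replaced by the sum over all
    -- members of `C`. After exchanging the sums each fixed trace costs one exponential moment.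
    ∑-weight-selection : ∀ {N} (C : Vec Bool N → Bool) (trace : Vec Bool N → Vec Bool N) →
      (∀ I → C (trace I) ≡ true) →
      ∑ (λ I → weight I (trace I)) ≤ card C * suc (2 * (suc y * y)) ^ N
    ∑-weight-selection {N} C trace trace∈ = begin
      ∑ (λ I → weight I (trace I))                          ≤⟨ ∑-mono-≤ select ⟩
      ∑ (λ I → ∑ (λ c → indicator (C c) * weight I c))      ≡⟨ ∑-comm (λ I c → indicator (C c) * weight I c) ⟩
      ∑ (λ c → ∑ (λ I → indicator (C c) * weight I c))
        ≡⟨ ∑-cong (λ c → sym (*-distribˡ-∑ (indicator (C c)) (λ I → weight I c))) ⟩
      ∑ (λ c → indicator (C c) * ∑ (λ I → weight I c))
        ≤⟨ ∑-mono-≤ (λ c → *-monoʳ-≤ (indicator (C c)) (∑-weight c)) ⟩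
      ∑ (λ c → indicator (C c) * h ^ N)                     ≡⟨ *-distribʳ-∑ (h ^ N) (indicator ∘ C) ⟨
      card C * h ^ N                                        ∎
      where
      open ≤-Reasoning
      h = suc (2 * (suc y * y))
      select : ∀ I → weight I (trace I) ≤ ∑ (λ c → indicator (C c) * weight I c)
      select I = begin
        weight I (trace I)                                 ≡⟨ *-identityˡ _ ⟨
        1 * weight I (trace I)                             ≡⟨ cong (λ b → indicator b * weight I (trace I)) (trace∈ I) ⟨
        indicator (C (trace I)) * weight I (trace I)       ≤⟨ term≤∑ (λ c → indicator (C c) * weight I c) (trace I) ⟩
        ∑ (λ c → indicator (C c) * weight I c)             ∎

    -- Summing `score-weight` over all I, the main term 2^N (N + d) τ cancels and leaves an excess
    -- 2^N d τ for the weights to cover. As N = E d, the powers group into d blocks of E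
    -- coordinates, and cancelling d turns the factor N into E.
    card-lower-bound : ∀ E d .{{_ : NonZero d}} → let N = E * d ; h = 2 * (suc y * y) in
      (C : Vec Bool N → Bool) (trace : Vec Bool N → Vec Bool N) →
      (∀ I → C (trace I) ≡ true) →
      2 ^ N * (N + 2 * d) ≤ ∑ (λ I → score I (trace I)) →
      (suc y * h ^ E) ^ d ≤ E * card C * (y * suc h ^ E) ^ d
    card-lower-bound E d C trace trace∈ large = *-cancelˡ-≤ d (begin
      d * (x * h ^ E) ^ d              ≡⟨ cong (d *_) ([m*n^o]^p≡m^p*n^[o*p] x h E d) ⟩
      d * (x ^ d * h ^ N)              ≡⟨ cong (λ z → d * (x ^ d * z)) (^-distribʳ-* 2 (x * y) N) ⟩
      d * (x ^ d * (2 ^ N * (x * y) ^ N)) ≡⟨ rearrange₁ d (x ^ d) (2 ^ N) ((x * y) ^ N) ⟩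
      2 ^ N * d * τ                    ≤⟨ +-cancelˡ-≤ (2 ^ N * ((N + d) * τ)) _ _ excess ⟩
      N * y ^ d * (card C * suc h ^ N) ≡⟨ rearrange₂ E d (y ^ d) (card C) (suc h ^ N) ⟩
      d * (E * card C * (y ^ d * suc h ^ N)) ≡⟨ cong (λ z → d * (E * card C * z)) ([m*n^o]^p≡m^p*n^[o*p] y (suc h) E d) ⟨
      d * (E * card C * (y * suc h ^ E) ^ d) ∎)
      where
      open ≤-Reasoning
      N = E * d
      x = suc y
      h = 2 * (x * y)
      τ = x ^ d * (x * y) ^ N
      rearrange₁ : ∀ d X T Z → d * (X * (T * Z)) ≡ T * d * (X * Z)
      rearrange₁ = solve-∀
      rearrange₂ : ∀ E d Y c H → E * d * Y * (c * H) ≡ d * (E * c * (Y * H))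
      rearrange₂ = solve-∀
      rearrange₃ : ∀ T N d τ → T * ((N + d) * τ) + T * d * τ ≡ T * (N + 2 * d) * τ
      rearrange₃ = solve-∀
      excess : 2 ^ N * ((N + d) * τ) + 2 ^ N * d * τ ≤ 2 ^ N * ((N + d) * τ) + N * y ^ d * (card C * suc h ^ N)
      excess = begin
        2 ^ N * ((N + d) * τ) + 2 ^ N * d * τ                ≡⟨ rearrange₃ (2 ^ N) N d τ ⟩
        2 ^ N * (N + 2 * d) * τ                              ≤⟨ *-monoˡ-≤ τ large ⟩
        ∑ (λ I → score I (trace I)) * τ                      ≡⟨ *-distribʳ-∑ τ (λ I → score I (trace I)) ⟩
        ∑ (λ I → score I (trace I) * τ)                      ≤⟨ ∑-mono-≤ (λ I → score-weight d I (trace I)) ⟩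
        ∑ (λ I → (N + d) * τ + N * y ^ d * weight I (trace I))
          ≡⟨ ∑-distrib-+ (λ _ → (N + d) * τ) (λ I → N * y ^ d * weight I (trace I)) ⟩
        ∑ {N} (λ _ → (N + d) * τ) + ∑ (λ I → N * y ^ d * weight I (trace I))
          ≡⟨ cong₂ _+_ (∑-const N ((N + d) * τ)) (sym (*-distribˡ-∑ (N * y ^ d) (λ I → weight I (trace I)))) ⟩
        2 ^ N * ((N + d) * τ) + N * y ^ d * ∑ (λ I → weight I (trace I))
          ≤⟨ +-monoʳ-≤ (2 ^ N * ((N + d) * τ)) (*-monoʳ-≤ (N * y ^ d) (∑-weight-selection C trace trace∈)) ⟩
        2 ^ N * ((N + d) * τ) + N * y ^ d * (card C * suc h ^ N) ∎

  -- Choice of the constants.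

  -- With y = E a block of E coordinates yields the concentration factor a / b > 1, and g is so large
  -- that the Sauer–Shelah factor ((g + 1) / g)^E per block does not use it up; after d blocks the
  -- remaining ratio exceeds 1 + 1/β per block and beats the constant E g^n.
  module Threshold (E n : ℕ) .{{E≢0 : NonZero E}} where

    h a b g β d : ℕ
    h = 2 * (suc E * E)
    a = suc E * h ^ E
    b = E * suc h ^ E
    g = a * E
    β = b * suc g ^ E
    d = suc (E * g ^ n * β)

    instance
      b≢0 : NonZero b
      b≢0 = m*n≢0 E _ {{E≢0}} {{m^n≢0 (suc h) E}}
      β≢0 : NonZero β
      β≢0 = m*n≢0 b _ {{b≢0}} {{m^n≢0 (suc g) E}}
      g≢0 : NonZero g
      g≢0 = m*n≢0 a E {{m*n≢0 (suc E) _ {{_}} {{m^n≢0 h E {{m*n≢0 2 _ {{_}} {{m*n≢0 (suc E) E}}}}}}}}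

    b<a : b < a
    -- The gap condition amounts to (E+1) E < h + 1, and h is twice (E+1) E.
    b<a = power-ratio-gap (suc E) E h E (begin-strict
      E * suc h + suc E * E            <⟨ +-monoʳ-< (E * suc h) (s≤s (m≤m+n (suc E * E) _)) ⟩
      E * suc h + suc h                ≡⟨ +-comm (E * suc h) (suc h) ⟩
      suc E * suc h                    ∎)
      where open ≤-Reasoning

    -- The choice g = a E makes the loss a E in the gap condition equal to g, while `b<a` gains at
    -- least g + 1.
    β<a*g^E : β < a * g ^ E
    β<a*g^E = power-ratio-gap a b g E (begin-strict
      b * suc g + g                    <⟨ +-monoʳ-< (b * suc g) (n<1+n g) ⟩
      b * suc g + suc g                ≡⟨ +-comm (b * suc g) (suc g) ⟩
      suc b * suc g                    ≤⟨ *-monoˡ-≤ (suc g) b<a ⟩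
      a * suc g                        ∎)
      where open ≤-Reasoning

    -- Concentration bounds `card C` from below by (a/b)^d / E, and Sauer-Shelah bounds it from
    -- above by g^n ((g+1)/g)^(E d). The constants make these incompatible.
    small-score-sum : (C : Vec Bool (E * d) → Bool) → ¬ Shatters C n →
      (trace : Vec Bool (E * d) → Vec Bool (E * d)) → (∀ I → C (trace I) ≡ true) →
      ¬ (2 ^ (E * d) * (E * d + 2 * d) ≤ ∑ (λ I → score I (trace I)))
    small-score-sum C ¬sh trace trace∈ large = <-irrefl refl (begin-strict
      suc β ^ d                                 ≤⟨ ^-monoˡ-≤ d β<a*g^E ⟩
      (a * g ^ E) ^ d                           ≡⟨ [m*n^o]^p≡m^p*n^[o*p] a g E d ⟩
      a ^ d * g ^ (E * d)                       ≤⟨ *-monoˡ-≤ (g ^ (E * d)) (card-lower-bound E E d C trace trace∈ large) ⟩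
      E * card C * b ^ d * g ^ (E * d)          ≡⟨ rearrange₁ E (card C) (b ^ d) (g ^ (E * d)) ⟩
      E * b ^ d * (card C * g ^ (E * d))        ≤⟨ *-monoʳ-≤ (E * b ^ d) (sauer-shelah g (E * d) n C ¬sh) ⟩
      E * b ^ d * (g ^ n * suc g ^ (E * d))     ≡⟨ rearrange₂ E (b ^ d) (g ^ n) (suc g ^ (E * d)) ⟩
      E * g ^ n * (b ^ d * suc g ^ (E * d))     ≡⟨ cong (E * g ^ n *_) ([m*n^o]^p≡m^p*n^[o*p] b (suc g) E d) ⟨
      -- The definition of `d` is exactly the exponent that `power-dominates` asks for with base β
      -- and constant E g^n.
      E * g ^ n * β ^ d                         <⟨ power-dominates β (E * g ^ n) ⟩
      suc β ^ d                                 ∎)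
      where
      open ≤-Reasoning
      rearrange₁ : ∀ E c B G → E * c * B * G ≡ E * B * (c * G)
      rearrange₁ = solve-∀
      rearrange₂ : ∀ E B G H → E * B * (G * H) ≡ E * G * (B * H)
      rearrange₂ = solve-∀

open TraceCounting
open import Data.Rational using (ℚ; mkℚ; 0ℚ; 1ℚ; _+_; _*_; _-_; -_; _≤_; _<_; _/_; ↧ₙ_; toℚᵘ; positive; NonNegative; Positive)
open import Data.Rational.Properties
open import Data.Rational.Solver using (module +-*-Solver)
import Data.Rational.Unnormalised as ℚᵘ
import Data.Rational.Unnormalised.Properties as ℚᵘ

-- Natural numbers and fractions inside ℚ.

fromℕ : ℕ → ℚ
fromℕ n = pos n / 1

-- Since `_/_` reduces to lowest terms, it does not compute on variables. In unnormalised form the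
-- identities below become cross-multiplications of integers.
toℚᵘ-/ : ∀ i n .{{_ : NonZero n}} → toℚᵘ (i / n) ℚᵘ.≃ i ℚᵘ./ n
toℚᵘ-/ i (suc n) = toℚᵘ-fromℚᵘ (ℚᵘ.mkℚᵘ i n)

fromℕ-+ : ∀ m n → fromℕ (m ℕ.+ n) ≡ fromℕ m + fromℕ n
fromℕ-+ m n = toℚᵘ-injective (begin
  toℚᵘ (fromℕ (m ℕ.+ n))                  ≈⟨ toℚᵘ-/ (pos (m ℕ.+ n)) 1 ⟩
  pos (m ℕ.+ n) ℚᵘ./ 1                      ≈⟨ ℚᵘ.*≡* (cong (ℤ._* pos 1) (cong₂ ℤ._+_ (sym (ℤ.*-identityʳ (pos m))) (sym (ℤ.*-identityʳ (pos n))))) ⟩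
  (pos m ℚᵘ./ 1) ℚᵘ.+ (pos n ℚᵘ./ 1)          ≈⟨ ℚᵘ.+-cong (toℚᵘ-/ (pos m) 1) (toℚᵘ-/ (pos n) 1) ⟨
  toℚᵘ (fromℕ m) ℚᵘ.+ toℚᵘ (fromℕ n)      ≈⟨ toℚᵘ-homo-+ (fromℕ m) (fromℕ n) ⟨
  toℚᵘ (fromℕ m + fromℕ n)                ∎)
  where open ℚᵘ.≃-Reasoning

fromℕ-cancel-≤ : ∀ {m n} → fromℕ m ≤ fromℕ n → m ℕ.≤ n
fromℕ-cancel-≤ {m} {n} m≤n = ℤ.drop‿+≤+ (subst₂ ℤ._≤_ (ℤ.*-identityʳ (pos m)) (ℤ.*-identityʳ (pos n))
  (ℚᵘ.drop-*≤* (ℚᵘ.≤-trans (ℚᵘ.≤-reflexive (ℚᵘ.≃-sym (toℚᵘ-/ (pos m) 1)))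
    (ℚᵘ.≤-trans (toℚᵘ-mono-≤ m≤n) (ℚᵘ.≤-reflexive (toℚᵘ-/ (pos n) 1))))))

i/n≡1/n*i : ∀ i n .{{_ : NonZero n}} → i / n ≡ (pos 1 / n) * (i / 1)
i/n≡1/n*i i n@(suc _) = toℚᵘ-injective (begin
  toℚᵘ (i / n)                              ≈⟨ toℚᵘ-/ i n ⟩
  i ℚᵘ./ n                                  ≈⟨ ℚᵘ.*≡* (cong₂ ℤ._*_ (sym (ℤ.*-identityˡ i)) (cong pos (ℕ.*-identityʳ n))) ⟩
  (pos 1 ℚᵘ./ n) ℚᵘ.* (i ℚᵘ./ 1)              ≈⟨ ℚᵘ.*-cong (toℚᵘ-/ (pos 1) n) (toℚᵘ-/ i 1) ⟨
  toℚᵘ (pos 1 / n) ℚᵘ.* toℚᵘ (i / 1)          ≈⟨ toℚᵘ-homo-* (pos 1 / n) (i / 1) ⟨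
  toℚᵘ ((pos 1 / n) * (i / 1))                ∎)
  where open ℚᵘ.≃-Reasoning

n/n≡1 : ∀ n .{{_ : NonZero n}} → pos n / n ≡ 1ℚ
n/n≡1 n@(suc _) = toℚᵘ-injective (ℚᵘ.≃-trans (toℚᵘ-/ (pos n) n) (ℚᵘ.*≡* (ℤ.*-comm (pos n) (pos 1))))

fromℕ-* : ∀ m n → fromℕ (m ℕ.* n) ≡ fromℕ m * fromℕ n
fromℕ-* zero    n = sym (*-zeroˡ (fromℕ n))
fromℕ-* (suc m) n = begin
  fromℕ (n ℕ.+ m ℕ.* n)            ≡⟨ fromℕ-+ n (m ℕ.* n) ⟩
  fromℕ n + fromℕ (m ℕ.* n)        ≡⟨ cong₂ _+_ (sym (*-identityˡ (fromℕ n))) (fromℕ-* m n) ⟩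
  1ℚ * fromℕ n + fromℕ m * fromℕ n ≡⟨ *-distribʳ-+ (fromℕ n) 1ℚ (fromℕ m) ⟨
  (1ℚ + fromℕ m) * fromℕ n         ≡⟨ cong (_* fromℕ n) (fromℕ-+ 1 m) ⟨
  fromℕ (suc m) * fromℕ n          ∎
  where open ≡-Reasoning

fromℕ-nonNeg : ∀ n → NonNegative (fromℕ n)
fromℕ-nonNeg n = normalize-nonNeg n 1

+-interchangeℚ : ∀ w x y z → (w + x) + (y + z) ≡ (w + y) + (x + z)
+-interchangeℚ = solve 4 (λ w x y z → (w :+ x) :+ (y :+ z) := (w :+ y) :+ (x :+ z)) refl
  where open +-*-Solver

-- Finite sums and averages of rationals.

sumℚ-cong : ∀ {n} {f g : Fin n → ℚ} → (∀ i → f i ≡ g i) → sumℚ f ≡ sumℚ g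
sumℚ-cong {zero}  f≡g = refl
sumℚ-cong {suc n} f≡g = cong₂ _+_ (f≡g fzero) (sumℚ-cong (f≡g ∘ fsuc))

sumℚ-mono-≤ : ∀ {n} {f g : Fin n → ℚ} → (∀ i → f i ≤ g i) → sumℚ f ≤ sumℚ g
sumℚ-mono-≤ {zero}  f≤g = ≤-refl
sumℚ-mono-≤ {suc n} f≤g = +-mono-≤ (f≤g fzero) (sumℚ-mono-≤ (f≤g ∘ fsuc))

sumℚ-distrib-+ : ∀ {n} (f g : Fin n → ℚ) → sumℚ (λ i → f i + g i) ≡ sumℚ f + sumℚ g
sumℚ-distrib-+ {zero}  f g = refl
sumℚ-distrib-+ {suc n} f g = trans
  (cong (f fzero + g fzero +_) (sumℚ-distrib-+ (f ∘ fsuc) (g ∘ fsuc)))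
  (+-interchangeℚ (f fzero) (g fzero) (sumℚ (f ∘ fsuc)) (sumℚ (g ∘ fsuc)))

*-distribˡ-sumℚ : ∀ {n} c (f : Fin n → ℚ) → c * sumℚ f ≡ sumℚ (λ i → c * f i)
*-distribˡ-sumℚ {zero}  c f = *-zeroʳ c
*-distribˡ-sumℚ {suc n} c f = trans (*-distribˡ-+ c (f fzero) (sumℚ (f ∘ fsuc)))
  (cong (c * f fzero +_) (*-distribˡ-sumℚ c (f ∘ fsuc)))

sumℚ-const : ∀ n c → sumℚ {n} (λ _ → c) ≡ fromℕ n * c
sumℚ-const zero    c = sym (*-zeroˡ c)
sumℚ-const (suc n) c = begin
  c + sumℚ {n} (λ _ → c)         ≡⟨ cong₂ _+_ (sym (*-identityˡ c)) (sumℚ-const n c) ⟩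
  1ℚ * c + fromℕ n * c           ≡⟨ *-distribʳ-+ c 1ℚ (fromℕ n) ⟨
  (1ℚ + fromℕ n) * c             ≡⟨ cong (_* c) (fromℕ-+ 1 n) ⟨
  fromℕ (suc n) * c              ∎
  where open ≡-Reasoning

sumℚ-comm : ∀ {m n} (f : Fin m → Fin n → ℚ) → sumℚ (λ i → sumℚ (f i)) ≡ sumℚ (λ j → sumℚ (λ i → f i j))
sumℚ-comm {zero} {n} f = sym (trans (sumℚ-const n 0ℚ) (*-zeroʳ (fromℕ n)))
sumℚ-comm {suc m}    f = trans (cong (sumℚ (f fzero) +_) (sumℚ-comm (f ∘ fsuc)))
  (sym (sumℚ-distrib-+ (f fzero) (λ j → sumℚ (λ i → f (fsuc i) j))))

-- Written as the averages in `ShatteredByAverages` are, so that the bounds given there are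
-- literally bounds on `avg`.
avg : ∀ {k} → (Fin (suc k) → ℚ) → ℚ
avg {k} f = (pos 1 / suc k) * sumℚ f

avg-cong : ∀ {k} {f g : Fin (suc k) → ℚ} → (∀ i → f i ≡ g i) → avg f ≡ avg g
avg-cong {k} f≡g = cong ((pos 1 / suc k) *_) (sumℚ-cong f≡g)

avg-const : ∀ {k} c → avg {k} (λ _ → c) ≡ c
avg-const {k} c = begin
  (pos 1 / suc k) * sumℚ {suc k} (λ _ → c)   ≡⟨ cong ((pos 1 / suc k) *_) (sumℚ-const (suc k) c) ⟩
  (pos 1 / suc k) * (fromℕ (suc k) * c)      ≡⟨ *-assoc (pos 1 / suc k) (fromℕ (suc k)) c ⟨
  (pos 1 / suc k) * fromℕ (suc k) * c        ≡⟨ cong (_* c) (i/n≡1/n*i (pos (suc k)) (suc k)) ⟨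
  (pos (suc k) / suc k) * c                    ≡⟨ cong (_* c) (n/n≡1 (suc k)) ⟩
  1ℚ * c                                   ≡⟨ *-identityˡ c ⟩
  c                                        ∎
  where open ≡-Reasoning

avg-distrib-+ : ∀ {k} (f g : Fin (suc k) → ℚ) → avg (λ i → f i + g i) ≡ avg f + avg g
avg-distrib-+ {k} f g = trans (cong ((pos 1 / suc k) *_) (sumℚ-distrib-+ f g)) (*-distribˡ-+ (pos 1 / suc k) _ _)

sumℚ-avg : ∀ {k n} (f : Fin n → Fin (suc k) → ℚ) → sumℚ (λ i → avg (f i)) ≡ avg (λ j → sumℚ (λ i → f i j))
sumℚ-avg {k} f = trans (sym (*-distribˡ-sumℚ (pos 1 / suc k) (λ i → sumℚ (f i)))) (cong ((pos 1 / suc k) *_) (sumℚ-comm f))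

*-distribˡ-avg : ∀ {k} c (f : Fin (suc k) → ℚ) → c * avg f ≡ avg (λ i → c * f i)
*-distribˡ-avg {k} c f = trans (swap c (pos 1 / suc k) (sumℚ f)) (cong ((pos 1 / suc k) *_) (*-distribˡ-sumℚ c f))
  where
  open +-*-Solver
  swap : ∀ c w x → c * (w * x) ≡ w * (c * x)
  swap = solve 3 (λ c w x → c :* (w :* x) := w :* (c :* x)) refl

avg-affine : ∀ {k} a (f : Fin (suc k) → ℚ) → avg (λ i → 1ℚ + a * f i) ≡ 1ℚ + a * avg f
avg-affine {k} a f = trans (avg-distrib-+ (λ _ → 1ℚ) (λ i → a * f i)) (cong₂ _+_ (avg-const {k} 1ℚ) (sym (*-distribˡ-avg a f)))

avg-comm : ∀ {k l} (f : Fin (suc k) → Fin (suc l) → ℚ) → avg (λ i → avg (f i)) ≡ avg (λ j → avg (λ i → f i j))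
avg-comm {k} f = trans (cong ((pos 1 / suc k) *_) (sumℚ-avg f)) (*-distribˡ-avg (pos 1 / suc k) (λ j → sumℚ (λ i → f i j)))

argmax : ∀ {k} (f : Fin (suc k) → ℚ) → ∃ λ i → ∀ j → f j ≤ f i
argmax {zero}  f = fzero , λ { fzero → ≤-refl }
argmax {suc k} f with argmax (f ∘ fsuc)
... | i , max with ≤-total (f fzero) (f (fsuc i))
...   | inj₁ 0≤i = fsuc i , λ { fzero → 0≤i ; (fsuc j) → max j }
...   | inj₂ i≤0 = fzero , λ { fzero → ≤-refl ; (fsuc j) → ≤-trans (max j) i≤0 }

avg≤some : ∀ {k} (f : Fin (suc k) → ℚ) → ∃ λ i → avg f ≤ f i
avg≤some {k} f with argmax f
... | i , max = i , subst (avg f ≤_) (avg-const {k} (f i))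
  (*-monoˡ-≤-nonNeg (pos 1 / suc k) {{normalize-nonNeg 1 (suc k)}} (sumℚ-mono-≤ {suc k} max))

-- Rational sums over the cube.

∑ℚ : ∀ {N} → (Vec Bool N → ℚ) → ℚ
∑ℚ = cubeSum _+_

∑ℚ-cong : ∀ {N} {f g : Vec Bool N → ℚ} → (∀ v → f v ≡ g v) → ∑ℚ f ≡ ∑ℚ g
∑ℚ-cong = cubeSum-preserves _+_ _≡_ (cong₂ _+_)

∑ℚ-mono-≤ : ∀ {N} {f g : Vec Bool N → ℚ} → (∀ v → f v ≤ g v) → ∑ℚ f ≤ ∑ℚ g
∑ℚ-mono-≤ = cubeSum-preserves _+_ _≤_ +-mono-≤

∑ℚ-const : ∀ N c → ∑ℚ {N} (λ _ → c) ≡ fromℕ (2 ℕ.^ N) * c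
∑ℚ-const zero    c = sym (*-identityˡ c)
∑ℚ-const (suc N) c = begin
  ∑ℚ {N} (λ _ → c) + ∑ℚ {N} (λ _ → c)     ≡⟨ cong₂ _+_ (∑ℚ-const N c) (∑ℚ-const N c) ⟩
  p * c + p * c                           ≡⟨ double p c ⟩
  fromℕ 2 * p * c                         ≡⟨ cong (_* c) (fromℕ-* 2 (2 ℕ.^ N)) ⟨
  fromℕ (2 ℕ.^ suc N) * c                 ∎
  where
  open ≡-Reasoning
  open +-*-Solver
  p = fromℕ (2 ℕ.^ N)
  double : ∀ p c → p * c + p * c ≡ fromℕ 2 * p * c
  double = solve 2 (λ p c → p :* c :+ p :* c := con (fromℕ 2) :* p :* c) refl

-- Each bit occurs at coordinate i in half of the cube; the factor 2 on the left avoids halving 2^N.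
∑ℚ-coordinate : ∀ {N} (w : Bool → ℚ) (i : Fin N) →
  fromℕ 2 * ∑ℚ (λ I → w (lookup I i)) ≡ fromℕ (2 ℕ.^ N) * (w true + w false)
∑ℚ-coordinate {suc N} w fzero = begin
  fromℕ 2 * (∑ℚ {N} (λ _ → w true) + ∑ℚ {N} (λ _ → w false)) ≡⟨ cong (fromℕ 2 *_) (cong₂ _+_ (∑ℚ-const N (w true)) (∑ℚ-const N (w false))) ⟩
  fromℕ 2 * (p * w true + p * w false)    ≡⟨ factor (fromℕ 2) p (w true) (w false) ⟩
  fromℕ 2 * p * (w true + w false)        ≡⟨ cong (_* (w true + w false)) (fromℕ-* 2 (2 ℕ.^ N)) ⟨
  fromℕ (2 ℕ.^ suc N) * (w true + w false) ∎
  where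
  open ≡-Reasoning
  open +-*-Solver
  p = fromℕ (2 ℕ.^ N)
  factor : ∀ t p a b → t * (p * a + p * b) ≡ t * p * (a + b)
  factor = solve 4 (λ t p a b → t :* (p :* a :+ p :* b) := t :* p :* (a :+ b)) refl
∑ℚ-coordinate {suc N} w (fsuc i) = begin
  fromℕ 2 * (S + S)                       ≡⟨ double (fromℕ 2) S ⟩
  fromℕ 2 * (fromℕ 2 * S)                 ≡⟨ cong (fromℕ 2 *_) (∑ℚ-coordinate w i) ⟩
  fromℕ 2 * (p * (w true + w false))      ≡⟨ *-assoc (fromℕ 2) p (w true + w false) ⟨
  fromℕ 2 * p * (w true + w false)        ≡⟨ cong (_* (w true + w false)) (fromℕ-* 2 (2 ℕ.^ N)) ⟨
  fromℕ (2 ℕ.^ suc N) * (w true + w false) ∎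
  where
  open ≡-Reasoning
  open +-*-Solver
  p = fromℕ (2 ℕ.^ N)
  S = ∑ℚ (λ I → w (lookup I i))
  double : ∀ t S → t * (S + S) ≡ t * (fromℕ 2 * S)
  double = solve 2 (λ t S → t :* (S :+ S) := t :* (con (fromℕ 2) :* S)) refl

sumℚ-∑ℚ : ∀ {n N} (f : Fin n → Vec Bool N → ℚ) → sumℚ (λ i → ∑ℚ (f i)) ≡ ∑ℚ (λ I → sumℚ (λ i → f i I))
sumℚ-∑ℚ {zero}  {N} f = sym (trans (∑ℚ-const N 0ℚ) (*-zeroʳ (fromℕ (2 ℕ.^ N))))
sumℚ-∑ℚ {suc n}     f = trans (cong (∑ℚ (f fzero) +_) (sumℚ-∑ℚ (f ∘ fsuc)))
  (sym (cubeSum-distrib _+_ +-interchangeℚ (f fzero) (λ I → sumℚ (λ i → f (fsuc i) I))))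

avg-∑ℚ : ∀ {k N} (f : Fin (suc k) → Vec Bool N → ℚ) → avg (λ j → ∑ℚ (f j)) ≡ ∑ℚ (λ I → avg (λ j → f j I))
avg-∑ℚ {k} f = trans (cong ((pos 1 / suc k) *_) (sumℚ-∑ℚ f))
  (cubeSum-homo _+_ _+_ ((pos 1 / suc k) *_) (*-distribˡ-+ (pos 1 / suc k)) (λ I → sumℚ (λ j → f j I)))

-- Truth values as rationals, and the choice of points and parameters.

indicatorℚ : Bool → ℚ
indicatorℚ b = fromℕ (indicator b)

sumℚ-indicatorℚ : ∀ {n} (v : Fin n → Bool) → sumℚ (indicatorℚ ∘ v) ≡ fromℕ (countTrue v)
sumℚ-indicatorℚ {zero}  v = refl
sumℚ-indicatorℚ {suc n} v with v fzero
... | true  = trans (cong (1ℚ +_) (sumℚ-indicatorℚ (v ∘ fsuc))) (sym (fromℕ-+ 1 (countTrue (v ∘ fsuc))))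
... | false = trans (+-identityˡ _) (sumℚ-indicatorℚ (v ∘ fsuc))

-- Gives the measure of an instance of φ the same shape as the average over the parameters, so that
-- the two averages can be exchanged.
countTrue/≡avg : ∀ {k} (v : Fin (suc k) → Bool) → pos (countTrue v) / suc k ≡ avg (indicatorℚ ∘ v)
countTrue/≡avg {k} v = trans (i/n≡1/n*i (pos (countTrue v)) (suc k)) (cong ((pos 1 / suc k) *_) (sym (sumℚ-indicatorℚ v)))

sgn : Bool → ℚ
sgn true  = - 1ℚ
sgn false = 1ℚ

fromℕ-gain : ∀ b x → fromℕ (gain b x) ≡ 1ℚ + sgn b * indicatorℚ x
fromℕ-gain true  true  = refl
fromℕ-gain false true  = refl
fromℕ-gain true  false = refl
fromℕ-gain false false = refl

fromℕ-score : ∀ {N} (I : Vec Bool N) (f : Fin N → Bool) →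
  sumℚ (λ i → fromℕ (gain (lookup I i) (f i))) ≡ fromℕ (score I (tabulate f))
fromℕ-score []      f = refl
fromℕ-score (b ∷ I) f = trans (cong (fromℕ (gain b (f fzero)) +_) (fromℕ-score I (f ∘ fsuc)))
  (sym (fromℕ-+ (gain b (f fzero)) (score I (tabulate (f ∘ fsuc)))))

-- Shattering with the model theory removed: `v I i j l` stands for the truth value of φ at the l-th
-- point of μ_i and the j-th parameter of ν_I.
module Derandomisation {N : ℕ} (k : Fin N → ℕ) (t : Vec Bool N → ℕ)
  (v : ∀ I i → Fin (suc (t I)) → Fin (suc (k i)) → Bool)
  (r s : ℚ)
  (small : ∀ I i → lookup I i ≡ true → avg (λ j → avg (λ l → indicatorℚ (v I i j l))) ≤ r)
  (large : ∀ I i → lookup I i ≡ false → s ≤ avg (λ j → avg (λ l → indicatorℚ (v I i j l))))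
  where

  gainAt : ∀ i I → Fin (suc (t I)) → Fin (suc (k i)) → ℚ
  gainAt i I j l = fromℕ (gain (lookup I i) (v I i j l))

  guaranteed : Bool → ℚ
  guaranteed true  = 1ℚ - r
  guaranteed false = 1ℚ + s

  -- The gain is affine in the truth value, so both averages pass through it. For i in I the sign -1
  -- turns the upper bound r into the lower bound 1 - r.
  guaranteed≤avg : ∀ i I → guaranteed (lookup I i) ≤ avg (λ j → avg (gainAt i I j))
  guaranteed≤avg i I = subst (guaranteed (lookup I i) ≤_) (sym expand) (bound (lookup I i) refl)
    where
    A = avg (λ j → avg (λ l → indicatorℚ (v I i j l)))
    expand : avg (λ j → avg (gainAt i I j)) ≡ 1ℚ + sgn (lookup I i) * A
    expand = trans
      (avg-cong λ j → trans (avg-cong λ l → fromℕ-gain (lookup I i) (v I i j l))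
                            (avg-affine (sgn (lookup I i)) (λ l → indicatorℚ (v I i j l))))
      (avg-affine (sgn (lookup I i)) (λ j → avg (λ l → indicatorℚ (v I i j l))))
    bound : ∀ b → lookup I i ≡ b → guaranteed b ≤ 1ℚ + sgn b * A
    bound true  eq = +-monoʳ-≤ 1ℚ (subst (- r ≤_) (neg A) (neg-antimono-≤ (small I i eq)))
      where
      open +-*-Solver
      neg : ∀ A → - A ≡ - 1ℚ * A
      neg = solve 1 (λ A → :- A := (:- con 1ℚ) :* A) refl
    bound false eq = +-monoʳ-≤ 1ℚ (subst (s ≤_) (sym (*-identityˡ A)) (large I i eq))

  row-sum : ∀ i → Fin (suc (k i)) → ℚ
  row-sum i l = ∑ℚ (λ I → avg (λ j → gainAt i I j l))

  -- The point of μ_i has to serve all I at once, or the traces would not come from one sequence of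
  -- points. It is therefore chosen to be good for the sum over the whole cube.
  good-row : ∀ i → ∃ λ l → ∑ℚ (λ I → guaranteed (lookup I i)) ≤ row-sum i l
  good-row i = l , (begin
    ∑ℚ (λ I → guaranteed (lookup I i))              ≤⟨ ∑ℚ-mono-≤ (guaranteed≤avg i) ⟩
    ∑ℚ (λ I → avg (λ j → avg (gainAt i I j)))       ≡⟨ ∑ℚ-cong (λ I → avg-comm (gainAt i I)) ⟩
    ∑ℚ (λ I → avg (λ l → avg (λ j → gainAt i I j l))) ≡⟨ avg-∑ℚ (λ l I → avg (λ j → gainAt i I j l)) ⟨
    avg (row-sum i)                                 ≤⟨ proj₂ (avg≤some (row-sum i)) ⟩
    row-sum i l                                     ∎)
    where
    open ≤-Reasoning
    l = proj₁ (avg≤some (row-sum i))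

  row : ∀ i → Fin (suc (k i))
  row i = proj₁ (good-row i)

  -- Once the points are fixed, the sets I no longer interact. One parameter is chosen for each I,
  -- good for the sum over all i.
  good-column : ∀ I → ∃ λ j → avg (λ j → sumℚ (λ i → gainAt i I j (row i))) ≤ sumℚ (λ i → gainAt i I j (row i))
  good-column I = avg≤some (λ j → sumℚ (λ i → gainAt i I j (row i)))

  column : ∀ I → Fin (suc (t I))
  column I = proj₁ (good-column I)

  trace : Vec Bool N → Vec Bool N
  trace I = tabulate (λ i → v I i (column I) (row i))

  -- The two guaranteed values add up to 2 + (s - r), and each is attained on half of the cube.
  -- Neither choice of a best index lowers the total.
  score-sum : fromℕ N * (fromℕ (2 ℕ.^ N) * (fromℕ 2 + (s - r))) ≤ fromℕ 2 * fromℕ (∑ (λ I → score I (trace I)))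
  score-sum = begin
    fromℕ N * (fromℕ (2 ℕ.^ N) * (fromℕ 2 + (s - r)))
      ≡⟨ cong (λ x → fromℕ N * (fromℕ (2 ℕ.^ N) * x)) (regroup r s) ⟩
    fromℕ N * (fromℕ (2 ℕ.^ N) * (guaranteed true + guaranteed false))
      ≡⟨ sumℚ-const N (fromℕ (2 ℕ.^ N) * (guaranteed true + guaranteed false)) ⟨
    sumℚ {N} (λ i → fromℕ (2 ℕ.^ N) * (guaranteed true + guaranteed false))
      ≡⟨ sumℚ-cong {N} (∑ℚ-coordinate guaranteed) ⟨
    sumℚ {N} (λ i → fromℕ 2 * ∑ℚ (λ I → guaranteed (lookup I i)))
      ≡⟨ *-distribˡ-sumℚ {N} (fromℕ 2) (λ i → ∑ℚ (λ I → guaranteed (lookup I i))) ⟨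
    fromℕ 2 * sumℚ {N} (λ i → ∑ℚ (λ I → guaranteed (lookup I i)))
      ≤⟨ *-monoˡ-≤-nonNeg (fromℕ 2) (begin
        sumℚ {N} (λ i → ∑ℚ (λ I → guaranteed (lookup I i)))       ≤⟨ sumℚ-mono-≤ {N} (λ i → proj₂ (good-row i)) ⟩
        sumℚ {N} (λ i → ∑ℚ (λ I → avg (λ j → gainAt i I j (row i)))) ≡⟨ sumℚ-∑ℚ (λ i I → avg (λ j → gainAt i I j (row i))) ⟩
        ∑ℚ (λ I → sumℚ {N} (λ i → avg (λ j → gainAt i I j (row i)))) ≡⟨ ∑ℚ-cong (λ I → sumℚ-avg (λ i j → gainAt i I j (row i))) ⟩
        ∑ℚ (λ I → avg (λ j → sumℚ {N} (λ i → gainAt i I j (row i)))) ≤⟨ ∑ℚ-mono-≤ (λ I → proj₂ (good-column I)) ⟩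
        ∑ℚ (λ I → sumℚ {N} (λ i → gainAt i I (column I) (row i)))    ≡⟨ ∑ℚ-cong (λ I → fromℕ-score I (λ i → v I i (column I) (row i))) ⟩
        ∑ℚ (λ I → fromℕ (score I (trace I)))                     ≡⟨ cubeSum-homo ℕ._+_ _+_ fromℕ fromℕ-+ (λ I → score I (trace I)) ⟨
        fromℕ (∑ (λ I → score I (trace I)))                      ∎) ⟩
    fromℕ 2 * fromℕ (∑ (λ I → score I (trace I))) ∎
    where
    open ≤-Reasoning
    open +-*-Solver
    regroup : ∀ r s → fromℕ 2 + (s - r) ≡ (1ℚ - r) + (1ℚ + s)
    regroup = solve 2 (λ r s → con (fromℕ 2) :+ (s :- r) := (con 1ℚ :- r) :+ (con 1ℚ :+ s)) refl

  -- With N = E d, the hypothesis `wide` gives N (s - r) ≥ 4 d, so the mean score N + N (s - r) / 2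
  -- is at least N + 2 d, the form used by the counting argument.
  score-sumℕ : ∀ E d → N ≡ E ℕ.* d → fromℕ 4 ≤ fromℕ E * (s - r) →
    2 ℕ.^ N ℕ.* (N ℕ.+ 2 ℕ.* d) ℕ.≤ ∑ (λ I → score I (trace I))
  score-sumℕ E d N≡ wide = fromℕ-cancel-≤ (*-cancelˡ-≤-pos (fromℕ 2) (begin
    fromℕ 2 * fromℕ (2 ℕ.^ N ℕ.* (N ℕ.+ 2 ℕ.* d))
      ≡⟨ cong (fromℕ 2 *_) (trans (fromℕ-* (2 ℕ.^ N) _) (cong (p *_) (trans (fromℕ-+ N _) (cong₂ _+_ N≡ℚ (fromℕ-* 2 d))))) ⟩
    fromℕ 2 * (p * (e * δ + fromℕ 2 * δ))   ≡⟨ rearrange₁ p e δ ⟩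
    p * δ * (fromℕ 2 * e + fromℕ 4)         ≤⟨ *-monoˡ-≤-nonNeg (p * δ) {{pδ-nonNeg}} (+-monoʳ-≤ (fromℕ 2 * e) wide) ⟩
    p * δ * (fromℕ 2 * e + e * (s - r))     ≡⟨ rearrange₂ p e δ (s - r) ⟩
    e * δ * (p * (fromℕ 2 + (s - r)))       ≡⟨ cong (_* (p * (fromℕ 2 + (s - r)))) N≡ℚ ⟨
    fromℕ N * (p * (fromℕ 2 + (s - r)))     ≤⟨ score-sum ⟩
    fromℕ 2 * fromℕ (∑ (λ I → score I (trace I))) ∎))
    where
    open ≤-Reasoning
    open +-*-Solver
    p = fromℕ (2 ℕ.^ N)
    e = fromℕ E
    δ = fromℕ d
    N≡ℚ : fromℕ N ≡ e * δ
    N≡ℚ = trans (cong fromℕ N≡) (fromℕ-* E d)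
    pδ-nonNeg : NonNegative (p * δ)
    pδ-nonNeg = subst NonNegative (fromℕ-* (2 ℕ.^ N) d) (fromℕ-nonNeg (2 ℕ.^ N ℕ.* d))
    rearrange₁ : ∀ p e δ → fromℕ 2 * (p * (e * δ + fromℕ 2 * δ)) ≡ p * δ * (fromℕ 2 * e + fromℕ 4)
    rearrange₁ = solve 3 (λ p e δ → con (fromℕ 2) :* (p :* (e :* δ :+ con (fromℕ 2) :* δ))
      := p :* δ :* (con (fromℕ 2) :* e :+ con (fromℕ 4))) refl
    rearrange₂ : ∀ p e δ x → p * δ * (fromℕ 2 * e + e * x) ≡ e * δ * (p * (fromℕ 2 + x))
    rearrange₂ = solve 4 (λ p e δ x → p :* δ :* (con (fromℕ 2) :* e :+ e :* x)
      := e :* δ :* (p :* (con (fromℕ 2) :+ x))) refl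

-- A positive rational times its denominator is its numerator, hence at least 1; so four times the
-- denominator of s - r will do.
scale-gap : ∀ {r s} → r < s → ∃ λ E → NonZero E × fromℕ 4 ≤ fromℕ E * (s - r)
scale-gap {r} {s} r<s = 4 ℕ.* ↧ₙ q , ℕ.m*n≢0 4 (↧ₙ q) , (begin
  fromℕ 4 * 1ℚ                      ≤⟨ *-monoˡ-≤-nonNeg (fromℕ 4) (1≤↧*self q {{q-pos}}) ⟩
  fromℕ 4 * (fromℕ (↧ₙ q) * q)      ≡⟨ *-assoc (fromℕ 4) (fromℕ (↧ₙ q)) q ⟨
  fromℕ 4 * fromℕ (↧ₙ q) * q        ≡⟨ cong (_* q) (fromℕ-* 4 (↧ₙ q)) ⟨
  fromℕ (4 ℕ.* ↧ₙ q) * q            ∎)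
  where
  open ≤-Reasoning
  q = s - r
  q-pos : Positive q
  q-pos = positive (subst (_< q) (+-inverseʳ r) (+-monoˡ-< (- r) r<s))
  1≤↧*self : ∀ p .{{_ : Positive p}} → 1ℚ ≤ fromℕ (↧ₙ p) * p
  1≤↧*self p@(mkℚ (pos (suc m)) n _) = toℚᵘ-cancel-≤ (ℚᵘ.≤-trans
    (ℚᵘ.*≤* (ℤ.+≤+ (ℕ.s≤s (ℕ.≤-trans (ℕ.≤-reflexive (trans (ℕ.+-identityʳ _) (ℕ.+-identityʳ n)))
      (ℕ.≤-trans (ℕ.m≤m*n n (suc m)) (ℕ.≤-trans (ℕ.m≤n+m _ m) (ℕ.≤-reflexive (sym (ℕ.*-identityʳ _)))))))))
    (ℚᵘ.≤-reflexive (ℚᵘ.≃-trans (ℚᵘ.*-congʳ (ℚᵘ.≃-sym (toℚᵘ-/ (pos (suc n)) 1))) (ℚᵘ.≃-sym (toℚᵘ-homo-* (fromℕ (suc n)) p)))))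

-- From shattering by averages to shattering in the model.

does⇒witness : {P : Set} (P? : Dec P) → does P? ≡ true → P
does⇒witness (yes p) _ = p

theorem3p5 : (L : Signature) (T : Theory L) → Complete L T → NIP L T →
    (M : Structure L) → IsModel L T M →
    ∀ nx ny (φ : Formula L (nx +ℕ ny)) (r s : ℚ) → r < s →
    Σ ℕ λ N → ¬ (Σ (Fin N → AveMeasure M nx) λ μ → ShatteredByAverages M N μ φ r s)
theorem3p5 L T _ nip M M⊨T nx ny φ r s r<s = E ℕ.* d , unshatterable
  where
  -- `n` is a size that φ shatters in no model of T. `E` comes from the gap s - r, and `d` from `E`
  -- and `n`.
  n = proj₁ (nip nx ny φ)
  E = proj₁ (scale-gap r<s)
  instance
    E≢0 : NonZero E
    E≢0 = proj₁ (proj₂ (scale-gap r<s))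
  open Threshold E n using (d; small-score-sum)

  unshatterable : ¬ (Σ (Fin (E ℕ.* d) → AveMeasure M nx) λ μ → ShatteredByAverages M (E ℕ.* d) μ φ r s)
  unshatterable (μ , shattered) = small-score-sum C C-unshattered trace trace∈
    (score-sumℕ E d refl (proj₂ (proj₂ (scale-gap r<s))))
    where
    N = E ℕ.* d
    -- Shattering is queried only at functions of the form `lookup I`, so that all later choices
    -- depend on vectors, which can be summed over and compared.
    t : Vec Bool N → ℕ
    t I = proj₁ (shattered (lookup I))
    parameter : ∀ I → Fin (suc (t I)) → Fin ny → Carrier M
    parameter I = proj₁ (proj₂ (shattered (lookup I)))
    q : ∀ I → Fin N → Fin (suc (t I)) → ℚ
    q I = proj₁ (proj₂ (proj₂ (shattered (lookup I))))
    measure : ∀ I i j → MeasureIs M (μ i) φ (parameter I j) (q I i j)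
    measure I = proj₁ (proj₂ (proj₂ (proj₂ (shattered (lookup I)))))
    bounds : ∀ I i → (lookup I i ≡ true → avg (q I i) ≤ r) × (lookup I i ≡ false → s ≤ avg (q I i))
    bounds I = proj₂ (proj₂ (proj₂ (proj₂ (shattered (lookup I)))))
    v : ∀ I i → Fin (suc (t I)) → Fin (suc (k′ (μ i))) → Bool
    v I i j = proj₁ (measure I i j)
    avg-q : ∀ I i → avg (q I i) ≡ avg (λ j → avg (λ l → indicatorℚ (v I i j l)))
    avg-q I i = avg-cong (λ j → trans (proj₂ (proj₂ (measure I i j))) (countTrue/≡avg (v I i j)))

    open Derandomisation (λ i → k′ (μ i)) t v r s
      (λ I i eq → subst (_≤ r) (avg-q I i) (proj₁ (bounds I i) eq))
      (λ I i eq → subst (s ≤_) (avg-q I i) (proj₂ (bounds I i) eq))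

    trace? : ∀ c → Dec (∃ λ I → trace I ≡ c)
    -- A `Subset` is a vector of Booleans, so a finite search decides membership in the image of
    -- `trace` and returns a preimage.
    trace? c = anySubset? (λ I → ≡-dec _≟ᵇ_ (trace I) c)

    C : Vec Bool N → Bool
    C c = does (trace? c)

    trace∈ : ∀ I → C (trace I) ≡ true
    trace∈ I = dec-true (trace? (trace I)) (I , refl)

    ∈⇒trace : ∀ c → C c ≡ true → ∃ λ I → trace I ≡ c
    ∈⇒trace c = does⇒witness (trace? c)

    -- Every trace is realised by one parameter against the same fixed points. A shattered set of
    -- coordinates would thus turn into points and parameters of M shattering φ at size n, against
    -- NIP.
    C-unshattered : ¬ Shatters C n
    C-unshattered (f , sh) = proj₂ (nip nx ny φ) M M⊨T
      (a , b′ , realises)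
      where
      -- Any subset whose trace shows the pattern J along `f`; the subset itself need not agree with
      -- J there.
      I : (Fin n → Bool) → Vec Bool N
      I J = proj₁ (∈⇒trace (proj₁ (sh J)) (proj₁ (proj₂ (sh J))))
      a : Fin n → Fin nx → Carrier M
      a l = pts (μ (f l)) (row (f l))
      b′ : (Fin n → Bool) → Fin ny → Carrier M
      b′ J = parameter (I J) (column (I J))
      agrees : ∀ J l → v (I J) (f l) (column (I J)) (row (f l)) ≡ J l
      agrees J l = begin
        v (I J) (f l) (column (I J)) (row (f l))   ≡⟨ lookup∘tabulate (λ i → v (I J) i (column (I J)) (row i)) (f l) ⟨
        lookup (trace (I J)) (f l)                 ≡⟨ cong (λ c → lookup c (f l)) (proj₂ (∈⇒trace (proj₁ (sh J)) (proj₁ (proj₂ (sh J))))) ⟩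
        lookup (proj₁ (sh J)) (f l)                ≡⟨ proj₂ (proj₂ (sh J)) l ⟩
        J l                                        ∎
        where open ≡-Reasoning
      realises : ∀ J l → (J l ≡ true) ⇔ SatP L M φ (a l) (b′ J)
      realises J l = subst (λ b → (b ≡ true) ⇔ SatP L M φ (a l) (b′ J)) (agrees J l)
        (proj₁ (proj₂ (measure (I J) (f l) (column (I J)))) (row (f l)))
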